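{- Let $x$ and $x'$ be nonempty modified ascent sequences, let $A=(\beta\circ\bar\alpha)(x)$ and $A'=(\beta\circ\bar\alpha)(x')$ be the corresponding Fishburn matrices, of dimension $p\times p$ and $k\times k$ respectively, with $p<k$, and let $x+x'$ denote the modified ascent sequence that corresponds to $A+A'$; that is, the modified ascent sequence with $(\beta\circ\bar\alpha)(x+x')=A+A'$. Then $$x+x'=\alpha\bigl(\mathfrak{P}(x)+\mathfrak{P}(x')\bigr),$$ where $\alpha$ is the map from Fishburn covers to modified ascent sequences given by the block-insertion procedure.
   Context: Write $[k]=\{1,\dots,k\}$. Trees. A binary tree is either empty or a triple $T=(L,r,R)$ with $r$ a node (the root) and $L,R$ binary trees. $V(T)$ is the set of nodes and the size of $T$ is $|V(T)|$. A vertex labeling is a map $\mathfrak{l}:V(T)\to\{1,2,\dots\}$; $\max(T)$ is the largest label, $\max(\emptyset)=0$. Labeled trees are considered up to label-preserving isomorphism. $T$ is decreasing if it is empty, or $L,R$ are decreasing and $\mathfrak{l}(r)\ge\max\{\max(L),\max(R)\}$; strictly decreasing to the left if it is empty, or $\mathfrak{l}(r)>\max(L)$ and $L,R$ are strictly decreasing to the left. An endotree of size $n$ is a decreasing binary tree of size $n$ that is strictly decreasing to the left with all labels in $[n]$; it is regular if its label set is $[k]$ for some $k\le n$. Let $v_i$ be the $i$-th node visited in the in-order traversal (left subtree, root, right subtree). $\mathrm{asctops}(T)=\{v_1\}\cup\{v_i:v_i\text{ has a left child}\}$, $\mathrm{nub}(T)=\{v_j:\mathfrak{l}(v_i)\ne\mathfrak{l}(v_j)\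 \forall i<j\}$. A Fishburn tree is a regular endotree with $\mathrm{nub}(T)=\mathrm{asctops}(T)$. Paths and covers. A maximal right path is a nonempty sequence of nodes, each the right child of the previous one, whose first node is not a right child and whose last node has no right child; maximal left paths are analogous. $\mathrm{rpath}(v)$ is the maximal right path containing $v$; $\mathrm{diag}(T)$ is the maximal left path containing the root. For a Fishburn tree $T$ with $k=\max(T)$, $\mathrm{asctops}(T)$ has exactly one node of each label $i\in[k]$; if $v$ is that node, $W_i=\mathrm{rpath}(v)$ if $v\in\mathrm{diag}(T)$ and $W_i=\mathrm{rpath}(\text{left child of }v)$ otherwise. Let $B_i$ be the multiset of labels of nodes of $W_i$ and $\mathfrak{P}(T)=B_1\dots B_k$. This is a Fishburn cover, i.e. a list of $k$ nonempty multisets whose elements form exactly the set $[k]$ and such that $j\in B_i$ implies $j\le i$. Sequences. A Cayley permutation is a word $x=x_1\dots x_n$ whose set of values is $[k]$ for some $k$. A modified ascent sequence is a Cayley permutation $x$ with $\mathrm{asctops}(x)=\mathrm{nub}(x)$, where $\mathrm{asctops}(x)=\{(1,x_1)\}\cup\{(i,x_i):1<i\le n,\,x_{i-1}<x_i\}$ and $\mathrm{nub}(x)=\{(\min x^{ -1}(j),j):1\le j\le\max(x)\}$. For a word $x$ of positive integers, $\bar\alpha(x)$ is the empty tree if $x$ is empty; otherwise, with $m$ the index of the leftmost maximum of $x$, $\bar\alpha(x)$ has root labeled $x_m$, left subtree $\bar\alpha(x_1\dots x_{m-1})$ and right subtree $\bar\alpha(x_{m+1}\dots x_n)$. It restricts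 to a bijection from modified ascent sequences to Fishburn trees, whose inverse is the in-order sequence. Put $\mathfrak{P}(x)=\mathfrak{P}(\bar\alpha(x))$. Matrices. A Fishburn matrix is a lower triangular square matrix with nonnegative integer entries and no zero row or column. For a Fishburn tree $T$ with $k=\max(T)$, $\beta(T)$ is the $k\times k$ matrix whose $(i,j)$-entry is the number of nodes with label $j$ in $W_i$; $\beta$ is a bijection from Fishburn trees to Fishburn matrices. For a $p\times p$ matrix $A=(a_{i,j})$ and a $k\times k$ matrix $A'=(a'_{i,j})$ with $p\le k$, $A+A'$ is the $k\times k$ matrix with $(i,j)$-entry $a_{i,j}+a'_{i,j}$ if $i\le p$ and $j\le p$, and $a'_{i,j}$ otherwise; the sum of two Fishburn matrices is a Fishburn matrix. Sum of covers. If $P=B_1\dots B_p$ and $P'=B'_1\dots B'_k$ are Fishburn covers with $p<k$, then $P+P'$ is the Fishburn cover $(B_1\cup B'_1)\dots(B_p\cup B'_p)B'_{p+1}\dots B'_k$, where $\cup$ denotes union of multisets with multiplicities added. The map $\alpha$ on covers (block-insertion procedure). Let $P=B_1\dots B_k$ be a Fishburn cover and let $\overrightarrow{B_i}$ be the word listing the elements of $B_i$ in weakly decreasing order. Let $\{i\in[k]:i\in B_i\}=\{i_1<\dots<i_p\}$ and $\{i\in[k]:i\notin B_i\}=\{j_1>\dots>j_q\}$. Let $x^{(0)}=\overrightarrow{B_{i_1}}\,\overrightarrow{B_{i_2}}\dots\overrightarrow{B_{i_p}}$ (concatenation), and for $s=1,\dots,q$ let $x^{(s)}$ be obtained from $x^{(s-1)}$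 by inserting $\overrightarrow{B_{j_s}}$ immediately before the leftmost occurrence of the integer $j_s$. Then $\alpha(P)=x^{(q)}$. -}

module Defs where

open import Data.Fin.Base as Fin using (Fin; zero; suc; toℕ; fromℕ<)
open import Data.List.Base as List
  using (List; []; _∷_; _++_; length; map; filter; find; foldr; foldl; head;
         concatMap; reverse; allFin)
open import Data.List.Membership.DecPropositional using (_∈?_)
open import Data.List.Membership.Propositional using (_∈_)
import Data.List.Sort as Sort
open import Data.Maybe.Base as Maybe using (Maybe; just; nothing; maybe)
open import Data.Maybe using (Is-just)
import Data.Maybe.Properties as Maybeₚ
import Data.Maybe.Relation.Unary.Any as MaybeAny
open import Data.Nat.Base using (ℕ; zero; suc; _+_; _≤_; _<_; _⊔_; z≤n; s≤s)
open import Data.Nat.Induction using (Acc; acc; <-wellFounded)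
open import Data.Nat.Properties
  using (_≟_; _<?_; _≤?_; ≤-decTotalOrder; m≤n⇒m≤1+n; ≤-refl)
open import Data.Product.Base using (Σ-syntax; ∃-syntax; _×_; _,_; proj₁; proj₂)
open import Data.Sum.Base using (_⊎_)
open import Data.Unit.Base using (tt)
open import Data.Vec.Base as Vec using (Vec; tabulate; lookup)
open import Function.Bundles using (_⇔_)
open import Level using (0ℓ)
open import Relation.Binary.Definitions using (DecidableEquality)
open import Relation.Binary.PropositionalEquality using (_≡_; refl; cong)
import Relation.Binary.Properties.DecTotalOrder as DTO
open import Relation.Nullary.Decidable using (Dec; yes; no; _⊎-dec_; map′; ¬?)
open import Relation.Unary using (Pred; _≐_)

------------------------------------------------------------------------
-- Labeled binary trees

data Tree : Set where
  empty : Tree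
  node  : (L : Tree) (a : ℕ) (R : Tree) → Tree

data Node : Tree → Set where
  here : ∀ {L a R} → Node (node L a R)
  inL  : ∀ {L a R} → Node L → Node (node L a R)
  inR  : ∀ {L a R} → Node R → Node (node L a R)

inL-injective : ∀ {L a R} {u v : Node L} → inL {L} {a} {R} u ≡ inL v → u ≡ v
inL-injective refl = refl

inR-injective : ∀ {L a R} {u v : Node R} → inR {L} {a} {R} u ≡ inR v → u ≡ v
inR-injective refl = refl

_≟ⁿ_ : ∀ {T} → DecidableEquality (Node T)
here  ≟ⁿ here  = yes refl
here  ≟ⁿ inL _ = no λ ()
here  ≟ⁿ inR _ = no λ ()
inL _ ≟ⁿ here  = no λ ()
inL u ≟ⁿ inL v = map′ (cong inL) inL-injective (u ≟ⁿ v)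
inL _ ≟ⁿ inR _ = no λ ()
inR _ ≟ⁿ here  = no λ ()
inR _ ≟ⁿ inL _ = no λ ()
inR u ≟ⁿ inR v = map′ (cong inR) inR-injective (u ≟ⁿ v)

label : ∀ {T} → Node T → ℕ
label (here {a = a}) = a
label (inL v)        = label v
label (inR v)        = label v

maxLabel : Tree → ℕ
maxLabel empty        = 0
maxLabel (node L a R) = a ⊔ (maxLabel L ⊔ maxLabel R)

root : ∀ T → Maybe (Node T)
root empty        = nothing
root (node _ _ _) = just here

leftChild : ∀ {T} → Node T → Maybe (Node T)
leftChild (here {L = L}) = Maybe.map inL (root L)
leftChild (inL v)        = Maybe.map inL (leftChild v)
leftChild (inR v)        = Maybe.map inR (leftChild v)

inorder : ∀ T → List (Node T)
inorder empty        = []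
inorder (node L a R) = map inL (inorder L) ++ here ∷ map inR (inorder R)

IsAsctop : ∀ {T} → Pred (Node T) 0ℓ
IsAsctop {T} v = head (inorder T) ≡ just v ⊎ Is-just (leftChild v)

isAsctop? : ∀ {T} (v : Node T) → Dec (IsAsctop v)
isAsctop? {T} v =
  Maybeₚ.≡-dec _≟ⁿ_ (head (inorder T)) (just v)
    ⊎-dec MaybeAny.dec (λ _ → yes tt) (leftChild v)

asctops : ∀ T → List (Node T)
asctops T = filter isAsctop? (inorder T)

------------------------------------------------------------------------
-- Maximal paths

leftSpine : ∀ T → List (Node T)
leftSpine empty        = []
leftSpine (node L a R) = here ∷ map inL (leftSpine L)

rightSpine : ∀ T → List (Node T)
rightSpine empty        = []
rightSpine (node L a R) = here ∷ map inR (rightSpine R)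

-- The root is not a left child, so the maximal left path containing it
-- starts there.
diag : ∀ T → List (Node T)
diag = leftSpine

-- Climb from v as long as the current node is a right child.
rtop : ∀ {T} → Node T → Node T
rtop here    = here
rtop (inL v) = inL (rtop v)
rtop (inR v) with rtop v
... | here  = here
... | inL u = inR (inL u)
... | inR u = inR (inR u)

-- v, its right child, the right child of that, and so on.
rightFrom : ∀ {T} → Node T → List (Node T)
rightFrom (here {L} {a} {R}) = rightSpine (node L a R)
rightFrom (inL v)            = map inL (rightFrom v)
rightFrom (inR v)            = map inR (rightFrom v)

rpath : ∀ {T} → Node T → List (Node T)
rpath v = rightFrom (rtop v)

------------------------------------------------------------------------
-- The paths W_i, Fishburn covers and matrices

asctopPath : ∀ {T} → Node T → List (Node T)
asctopPath {T} v with _∈?_ _≟ⁿ_ v (diag T)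
... | yes _ = rpath v
... | no  _ = maybe rpath [] (leftChild v)

-- In a Fishburn tree the asctop with label i ∈ [maxLabel T] exists and is
-- unique, so neither the choice made by find nor the default [] matters.
W : ∀ T → ℕ → List (Node T)
W T i = maybe asctopPath [] (find (λ v → label v ≟ i) (asctops T))

-- A list stands for the multiset of its entries: multisets are only ever
-- united (_++_) or listed in weakly decreasing order (↓).
Multiset : Set
Multiset = List ℕ

-- Entry i : Fin k of a cover or matrix carries the 1-based index toℕ i + 1.
index : ∀ {k} → Fin k → ℕ
index i = suc (toℕ i)

record Cover : Set where
  constructor mkCover
  field
    size   : ℕ
    blocks : Vec Multiset size

record SquareMatrix : Set where
  constructor mkMatrix
  field
    dim     : ℕ
    entries : Vec (Vec ℕ dim) dim

open Cover public
open SquareMatrix public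

𝔓 : Tree → Cover
𝔓 T = mkCover (maxLabel T) (tabulate λ i → map label (W T (index i)))

β : Tree → SquareMatrix
β T = mkMatrix (maxLabel T) (tabulate λ i → tabulate λ j →
  length (filter (λ v → label v ≟ index j) (W T (index i))))

------------------------------------------------------------------------
-- Sums

-- The index i of [k] seen as an index of [p], when i ≤ p.
restrict : ∀ {k} p → Fin k → Maybe (Fin p)
restrict p i with toℕ i <? p
... | yes i<p = just (fromℕ< i<p)
... | no  _   = nothing

infixl 6 _+ᴹ_ _+ᶜ_

-- Both sums have the size of the second argument; they are meant for a
-- first argument that is not larger.
_+ᴹ_ : SquareMatrix → SquareMatrix → SquareMatrix
mkMatrix p A +ᴹ mkMatrix k A′ =
  mkMatrix k (tabulate λ i → tabulate λ j →
    entry (restrict p i) (restrict p j) (lookup (lookup A′ i) j))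
  where
  entry : Maybe (Fin p) → Maybe (Fin p) → ℕ → ℕ
  entry (just i) (just j) a′ = lookup (lookup A i) j + a′
  entry _        _        a′ = a′

_+ᶜ_ : Cover → Cover → Cover
mkCover p P +ᶜ mkCover k P′ =
  mkCover k (tabulate λ i → block (restrict p i) (lookup P′ i))
  where
  block : Maybe (Fin p) → Multiset → Multiset
  block (just i) B′ = lookup P i ++ B′
  block nothing  B′ = B′

------------------------------------------------------------------------
-- Block insertion

open Sort (DTO.≥-decTotalOrder ≤-decTotalOrder) public
  using () renaming (sort to ↓)

insertBefore : ℕ → List ℕ → List ℕ → List ℕ
insertBefore j w []      = []
insertBefore j w (a ∷ x) with a ≟ j
... | yes _ = w ++ a ∷ x
... | no  _ = a ∷ insertBefore j w x

α : Cover → List ℕ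
α (mkCover k P) =
  foldl (λ x j → insertBefore (index j) (↓ (lookup P j)) x)
        (concatMap (λ i → ↓ (lookup P i)) (filter inOwnBlock? (allFin k)))
        (reverse (filter (λ i → ¬? (inOwnBlock? i)) (allFin k)))
  where
  inOwnBlock? : (i : Fin k) → Dec (index i ∈ lookup P i)
  inOwnBlock? i = _∈?_ _≟_ (index i) (lookup P i)

------------------------------------------------------------------------
-- Modified ascent sequences

IsCayley : Pred (List ℕ) 0ℓ
IsCayley x = ∃[ k ] ∀ a → a ∈ x ⇔ (1 ≤ a × a ≤ k)

maxʷ : List ℕ → ℕ
maxʷ = foldr _⊔_ 0

asctopsʷ : (x : List ℕ) → Pred (Fin (length x) × ℕ) 0ℓ
asctopsʷ x (i , a) =
  List.lookup x i ≡ a ×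
  (toℕ i ≡ 0 ⊎
   Σ[ h ∈ Fin (length x) ] (suc (toℕ h) ≡ toℕ i × List.lookup x h < List.lookup x i))

nubʷ : (x : List ℕ) → Pred (Fin (length x) × ℕ) 0ℓ
nubʷ x (i , j) =
  (1 ≤ j × j ≤ maxʷ x) ×
  List.lookup x i ≡ j ×
  (∀ h → List.lookup x h ≡ j → i Fin.≤ h)

IsModifiedAscent : Pred (List ℕ) 0ℓ
IsModifiedAscent x = IsCayley x × asctopsʷ x ≐ nubʷ x

------------------------------------------------------------------------
-- The tree of a word

-- splitMax a x = (u , m , w), where a ∷ x = u ++ m ∷ w and this m is the
-- leftmost maximum of a ∷ x.
splitMax : ℕ → List ℕ → List ℕ × ℕ × List ℕ
splitMax a []      = [] , a , []
splitMax a (b ∷ x) with splitMax b x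
... | u , m , w with m ≤? a
...   | yes _ = [] , a , b ∷ x
...   | no  _ = a ∷ u , m , w

splitMax-left : ∀ a x → length (proj₁ (splitMax a x)) ≤ length x
splitMax-left a []      = z≤n
splitMax-left a (b ∷ x) with splitMax b x | splitMax-left b x
... | u , m , w | u≤x with m ≤? a
...   | yes _ = z≤n
...   | no  _ = s≤s u≤x

splitMax-right : ∀ a x → length (proj₂ (proj₂ (splitMax a x))) ≤ length x
splitMax-right a []      = z≤n
splitMax-right a (b ∷ x) with splitMax b x | splitMax-right b x
... | u , m , w | w≤x with m ≤? a
...   | yes _ = ≤-refl
...   | no  _ = m≤n⇒m≤1+n w≤x

ᾱ-acc : (x : List ℕ) → Acc _<_ (length x) → Tree
ᾱ-acc []      _        = empty
ᾱ-acc (a ∷ x) (acc rs) =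
  node (ᾱ-acc (proj₁ s) (rs (s≤s (splitMax-left a x))))
       (proj₁ (proj₂ s))
       (ᾱ-acc (proj₂ (proj₂ s)) (rs (s≤s (splitMax-right a x))))
  where
  s : List ℕ × ℕ × List ℕ
  s = splitMax a x

ᾱ : List ℕ → Tree
ᾱ x = ᾱ-acc x (<-wellFounded (length x))

{-# OPTIONS --safe #-}

-- α only sees the multiplicities in the blocks of a cover, and for the cover of
-- a tree these are the entries of its matrix, so it suffices that α recovers the
-- in-order word of the tree of x+x′ from the blocks W_i.  The words that occur
-- in the block insertion are the in-order words of prunings of the tree: before
-- the block of index j is inserted, the left subtrees of the nodes off the
-- diagonal with label at most j are missing.  Since the tree is strictly
-- decreasing to the left, inserting that block is the same as lowering the
-- threshold from j to j − 1.

module Submission where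

open import Defs
open import Data.Bool.Base using (true; false)
open import Data.Empty using (⊥)
open import Data.Fin.Base as Fin using (Fin; zero; suc; toℕ; fromℕ<)
open import Data.Fin.Properties using (toℕ-fromℕ<; toℕ-injective; toℕ-cast; toℕ<n)
open import Data.List.Base as List
  using (List; []; _∷_; _++_; _∷ʳ′_; initLast; length; map; filter; find; foldr; head;
         concatMap; allFin)
open import Data.List.Membership.DecPropositional using () renaming (_∈?_ to _∈ⁿ?_)
open import Data.List.Membership.Propositional using (_∈_; _∉_)
open import Data.List.Membership.Propositional.Properties
  using (∈-++⁺ˡ; ∈-++⁺ʳ; ∈-++⁻; ∈-∃++; ∈-map⁺; ∈-map⁻; ∈-filter⁺; ∈-filter⁻)
open import Data.List.Properties
  using (++-assoc; ++-conicalʳ; ++-identityʳ; reverse-foldl; map-∘; ∷ʳ-injectiveʳ;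
         filter-accept; filter-none; filter-++; length-++)
open import Data.List.Relation.Binary.Permutation.Propositional
  using (_↭_; ↭-sym; ↭-trans; ↭⇒↭ₛ)
open import Data.List.Relation.Binary.Permutation.Propositional.Properties
  using (∈-resp-↭; ↭-length; filter-↭; shift)
open import Data.List.Relation.Binary.Pointwise using (Pointwise-≡⇒≡)
open import Data.List.Relation.Unary.All as All using (All; []; _∷_)
import Data.List.Relation.Unary.All.Properties as Allₚ
open import Data.List.Relation.Unary.AllPairs using (AllPairs; []; _∷_)
open import Data.List.Relation.Unary.Any using (here; there)
open import Data.List.Relation.Unary.Sorted.TotalOrder.Properties
  using (↗↭↗⇒≋; AllPairs⇒Sorted)
import Data.List.Sort as Sort
open import Data.Maybe using (Is-just)
open import Data.Maybe.Base using (just; nothing; maybe)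
open import Data.Maybe.Relation.Unary.Any using (just)
open import Data.Nat.Base
  using (ℕ; zero; suc; _+_; _≤_; _<_; _≥_; _⊔_; _≡ᵇ_; z≤n; s≤s)
open import Data.Nat.Induction using (acc)
open import Data.Nat.Properties
open import Data.List.Membership.DecPropositional _≟_ using (_∈?_)
open import Data.Product.Base using (Σ-syntax; ∃-syntax; _×_; _,_; proj₁; proj₂)
open import Data.Sum.Base using (_⊎_; inj₁; inj₂)
open import Data.Unit.Base using (tt)
open import Data.Vec.Base as Vec using (Vec; lookup)
import Data.Vec.Properties as Vecₚ
open import Function.Base using (_∘_)
open import Function.Bundles using (Equivalence)
import Relation.Binary.Properties.DecTotalOrder as DTO
open import Relation.Binary.PropositionalEquality
open import Relation.Nullary.Decidable using (Dec; yes; no; ¬?; decidable-stable)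
open import Relation.Nullary.Negation using (¬_; contradiction)

open Sort (DTO.≥-decTotalOrder ≤-decTotalOrder) using (sort-↭; sort-↗)

-- Block insertion in words

-- Insertion acts at the leftmost occurrence of j, whereas a lower threshold reopens the left
-- subtrees of all nodes labeled j off the diagonal. The two agree because at most one node labeled
-- j has a left subtree, and it is the leftmost one (`LeftFresh`); this comes from the inclusion of
-- ascent tops in first occurrences. Diagonal nodes escape the threshold because W_j is then the
-- right path of the node itself: it contains j, so it belongs to the starting word and nothing is
-- inserted for j. Hence the two prunings, `expandDiag` along the diagonal and `expand` off it.

module _ {j : ℕ} {w : List ℕ} where

  insertBefore-++-∈ : ∀ {x} z → j ∈ x → insertBefore j w (x ++ z) ≡ insertBefore j w x ++ z
  insertBefore-++-∈ {a ∷ x} z j∈ax with a ≟ j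
  ... | yes _ = sym (++-assoc w (a ∷ x) z)
  ... | no a≢j with j∈ax
  ...   | here refl = contradiction refl a≢j
  ...   | there j∈x = cong (a ∷_) (insertBefore-++-∈ z j∈x)

  insertBefore-++-∉ : ∀ x z → j ∉ x → insertBefore j w (x ++ z) ≡ x ++ insertBefore j w z
  insertBefore-++-∉ []      z j∉x = refl
  insertBefore-++-∉ (a ∷ x) z j∉x with a ≟ j
  ... | yes refl = contradiction (here refl) j∉x
  ... | no _     = cong (a ∷_) (insertBefore-++-∉ x z (j∉x ∘ there))

  insertBefore-here : ∀ z → insertBefore j w (j ∷ z) ≡ w ++ j ∷ z
  insertBefore-here z with j ≟ j
  ... | yes _  = refl
  ... | no j≢j = contradiction refl j≢j

-- Words and subtrees of a tree

word : Tree → List ℕ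
word empty        = []
word (node L a R) = word L ++ a ∷ word R

before : ∀ {T} → Node T → List ℕ
before (here {L = L})        = word L
before (inL v)               = before v
before (inR {L = L} {a = a} v) = word L ++ a ∷ before v

after : ∀ {T} → Node T → List ℕ
after (here {R = R})          = word R
after (inL {a = a} {R = R} v) = after v ++ a ∷ word R
after (inR v)                 = after v

leftTree : ∀ {T} → Node T → Tree
leftTree (here {L = L}) = L
leftTree (inL v)        = leftTree v
leftTree (inR v)        = leftTree v

rightTree : ∀ {T} → Node T → Tree
rightTree (here {R = R}) = R
rightTree (inL v)        = rightTree v
rightTree (inR v)        = rightTree v

-- Applied to the left subtree of an asctop off the diagonal, this is the block that gets inserted
-- before that asctop.
spine : Tree → List ℕ
spine empty        = []
spine (node L a R) = a ∷ spine R

data Diag : ∀ {T} → Node T → Set where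
  here : ∀ {L a R} → Diag (here {L} {a} {R})
  inL  : ∀ {L a R} {v : Node L} → Diag v → Diag (inL {L} {a} {R} v)

data Decreasing : Tree → Set where
  empty : Decreasing empty
  node  : ∀ {L a R} → Decreasing L → All (_< a) (word L) →
          Decreasing R → All (_≤ a) (word R) → Decreasing (node L a R)

-- The tree form of the inclusion of asctops in nub. It makes the leftmost node labeled j the only
-- one with that label that can carry a left subtree.
LeftFresh : Tree → Set
LeftFresh T = (v : Node T) → leftTree v ≢ empty → label v ∉ before v

word-split : ∀ {T} (v : Node T) → word T ≡ before v ++ label v ∷ after v
word-split here = refl
word-split (inL {a = a} {R = R} v) =
  trans (cong (_++ a ∷ word R) (word-split v)) (++-assoc (before v) _ _)
word-split (inR {L = L} {a = a} v) =
  trans (cong (λ z → word L ++ a ∷ z) (word-split v)) (sym (++-assoc (word L) _ _))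

label∈word : ∀ {T} (v : Node T) → label v ∈ word T
label∈word (here {L = L})        = ∈-++⁺ʳ (word L) (here refl)
label∈word (inL v)               = ∈-++⁺ˡ (label∈word v)
label∈word (inR {L = L} v)       = ∈-++⁺ʳ (word L) (there (label∈word v))

leftmost : ∀ T {j} → j ∈ word T → Σ[ v ∈ Node T ] (label v ≡ j × j ∉ before v)
leftmost (node L a R) {j} j∈ with j ∈? word L
... | yes j∈L = let v , eq , fresh = leftmost L j∈L in inL v , eq , fresh
... | no j∉L with a ≟ j
...   | yes eq = here , eq , j∉L
...   | no a≢j with ∈-++⁻ (word L) j∈
...     | inj₁ j∈L          = contradiction j∈L j∉L
...     | inj₂ (here j≡a)   = contradiction (sym j≡a) a≢j
...     | inj₂ (there j∈R)  =
  let v , eq , fresh = leftmost R j∈R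
  in inR v , eq , λ j∈′ → absurd (∈-++⁻ (word L) j∈′) fresh
  where
  absurd : ∀ {z} → j ∈ word L ⊎ j ∈ a ∷ z → j ∉ z → ⊥
  absurd (inj₁ j∈L)         _   = j∉L j∈L
  absurd (inj₂ (here j≡a))  _   = a≢j (sym j≡a)
  absurd (inj₂ (there j∈z)) j∉z = j∉z j∈z

LeftFresh-L : ∀ {L a R} → LeftFresh (node L a R) → LeftFresh L
LeftFresh-L fresh v = fresh (inL v)

LeftFresh-R : ∀ {L a R} → LeftFresh (node L a R) → LeftFresh R
LeftFresh-R {L} fresh v v≢ = fresh (inR v) v≢ ∘ ∈-++⁺ʳ (word L) ∘ there

spine⊆word : ∀ T {b} → b ∈ spine T → b ∈ word T
spine⊆word (node L a R) (here eq) = ∈-++⁺ʳ (word L) (here eq)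
spine⊆word (node L a R) (there b∈) = ∈-++⁺ʳ (word L) (there (spine⊆word R b∈))

spine-decreasing : ∀ {T} → Decreasing T → AllPairs _≥_ (spine T)
spine-decreasing empty = []
spine-decreasing (node {R = R} _ _ dR R≤a) =
  All.tabulate (λ b∈ → All.lookup R≤a (spine⊆word R b∈)) ∷ spine-decreasing dR

-- Partially inserted words

when : ∀ {P : Set} → Dec P → List ℕ → List ℕ
when (yes _) x = x
when (no _)  x = []

when-yes : ∀ {P : Set} (d : Dec P) {x} → P → when d x ≡ x
when-yes (yes _) _ = refl
when-yes (no ¬p) p = contradiction p ¬p

when-no : ∀ {P : Set} (d : Dec P) {x} → ¬ P → when d x ≡ []
when-no (yes p) ¬p = contradiction p ¬p
when-no (no _)  _  = refl

-- expandDiag t T is the word in which the blocks of index above t have been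
-- inserted; expand is the same with no node of T on the diagonal.
expand : ℕ → Tree → List ℕ
expand t empty        = []
expand t (node L a R) = when (t <? a) (expand t L) ++ a ∷ expand t R

expandDiag : ℕ → Tree → List ℕ
expandDiag t empty        = []
expandDiag t (node L a R) = expandDiag t L ++ a ∷ expand t R

-- The concatenated blocks of the diagonal nodes with label at most t.
diagUpTo : ℕ → Tree → List ℕ
diagUpTo t empty        = []
diagUpTo t (node L a R) = diagUpTo t L ++ when (a ≤? t) (a ∷ spine R)

NoLeft : ℕ → Tree → Set
NoLeft j T = (v : Node T) → label v ≡ j → leftTree v ≡ empty

expand-below : ∀ {t a} L R → t < a → expand t (node L a R) ≡ expand t L ++ a ∷ expand t R
expand-below {t} {a} L R t<a = cong (_++ a ∷ expand t R) (when-yes (t <? a) t<a)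

expand-above : ∀ {t a} L R → ¬ t < a → expand t (node L a R) ≡ a ∷ expand t R
expand-above {t} {a} L R t≮a = cong (_++ a ∷ expand t R) (when-no (t <? a) t≮a)

expand-0 : ∀ T → All (1 ≤_) (word T) → expand 0 T ≡ word T
expand-0 empty        _   = refl
expand-0 (node L a R) pos with Allₚ.++⁻ (word L) pos
... | posL , 1≤a ∷ posR = trans (expand-below L R 1≤a)
  (cong₂ (λ x z → x ++ a ∷ z) (expand-0 L posL) (expand-0 R posR))

expandDiag-0 : ∀ T → All (1 ≤_) (word T) → expandDiag 0 T ≡ word T
expandDiag-0 empty        _   = refl
expandDiag-0 (node L a R) pos with Allₚ.++⁻ (word L) pos
... | posL , 1≤a ∷ posR =
  cong₂ (λ x z → x ++ a ∷ z) (expandDiag-0 L posL) (expand-0 R posR)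

-- With no label above the threshold every left subtree is pruned. This is why a subtree that has
-- just been reopened shows up as one single block.
expand-bounded : ∀ {t} T → All (_≤ t) (word T) → expand t T ≡ spine T
expand-bounded empty        _ = refl
expand-bounded (node L a R) T≤t with Allₚ.++⁻ (word L) T≤t
... | _ , a≤t ∷ R≤t = trans (expand-above L R (≤⇒≯ a≤t)) (cong (a ∷_) (expand-bounded R R≤t))

-- Identifies the starting word of the block insertion with the most pruned word: the diagonal is
-- read from the bottom up, which is the order of increasing labels.
diagUpTo-bounded : ∀ {t} T → All (_≤ t) (word T) → diagUpTo t T ≡ expandDiag t T
diagUpTo-bounded empty _ = refl
diagUpTo-bounded {t} (node L a R) T≤t with Allₚ.++⁻ (word L) T≤t
... | L≤t , a≤t ∷ R≤t = cong₂ _++_ (diagUpTo-bounded L L≤t)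
  (trans (when-yes (a ≤? t) a≤t) (cong (a ∷_) (sym (expand-bounded R R≤t))))

diagUpTo-0 : ∀ T → All (1 ≤_) (word T) → diagUpTo 0 T ≡ []
diagUpTo-0 empty _ = refl
diagUpTo-0 (node L a R) pos with Allₚ.++⁻ (word L) pos
... | posL , 1≤a ∷ posR = cong₂ _++_ (diagUpTo-0 L posL) (when-no (a ≤? 0) (<⇒≱ 1≤a))

∉⇒NoLeft : ∀ {j T} → j ∉ word T → NoLeft j T
∉⇒NoLeft j∉ v refl = contradiction (label∈word v) j∉

empty? : (T : Tree) → T ≡ empty ⊎ T ≢ empty
empty? empty        = inj₁ refl
empty? (node _ _ _) = inj₂ λ ()

-- Every j in `R` has an earlier j in `L` or at the root, so freshness forbids it a left subtree.
NoLeft-R : ∀ {j L a R} → LeftFresh (node L a R) → j ∈ word L ++ a ∷ [] → NoLeft j R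
NoLeft-R {L = L} {a} fresh j∈ v refl with empty? (leftTree v)
... | inj₁ eq = eq
... | inj₂ ≢e = contradiction
  (subst (label v ∈_) (++-assoc (word L) (a ∷ []) (before v)) (∈-++⁺ˡ j∈)) (fresh (inR v) ≢e)

<∧≢⇒1+< : ∀ {t a} → t < a → a ≢ suc t → suc t < a
<∧≢⇒1+< t<a a≢ = ≤∧≢⇒< t<a (a≢ ∘ sym)

-- Lowering the threshold by one

module _ {t : ℕ} where

  -- The tests `t < a` and `suc t < a` differ only for a = `suc t`, and there the subtree in
  -- question is empty.
  expand-step : ∀ T → NoLeft (suc t) T → expand t T ≡ expand (suc t) T
  expand-step empty        _  = refl
  expand-step (node L a R) nl with a ≟ suc t
  ... | yes refl with refl ← nl here refl = cong₂ (λ x z → x ++ a ∷ z)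
    (trans (when-yes (t <? suc t) ≤-refl) (sym (when-no (suc t <? suc t) (<-irrefl refl))))
    (expand-step R (nl ∘ inR))
  ... | no a≢ with t <? a
  ...   | yes t<a = trans
    (cong₂ (λ x z → x ++ a ∷ z) (expand-step L (nl ∘ inL)) (expand-step R (nl ∘ inR)))
    (sym (expand-below L R (<∧≢⇒1+< t<a a≢)))
  ...   | no t≮a = trans (cong (a ∷_) (expand-step R (nl ∘ inR)))
    (sym (expand-above L R (t≮a ∘ <-trans (n<1+n t))))

  expandDiag-step : ∀ T → NoLeft (suc t) T → expandDiag t T ≡ expandDiag (suc t) T
  expandDiag-step empty        _  = refl
  expandDiag-step (node L a R) nl = cong₂ (λ x z → x ++ a ∷ z)
    (expandDiag-step L (nl ∘ inL)) (expand-step R (nl ∘ inR))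

  -- To the left of `v` all labels are smaller, and every later copy of `suc t` has `v` before it,
  -- so by freshness it has no left subtree to reopen.
  expandDiag-step-diag : ∀ {T} {v : Node T} → Diag v → Decreasing T → LeftFresh T →
    label v ≡ suc t → expandDiag t T ≡ expandDiag (suc t) T
  expandDiag-step-diag (here {L} {a} {R}) (node dL L<a dR R≤a) fresh refl =
    cong₂ (λ x z → x ++ a ∷ z)
      (expandDiag-step L (∉⇒NoLeft (<-irrefl refl ∘ All.lookup L<a)))
      (expand-step R (NoLeft-R fresh (∈-++⁺ʳ (word L) (here refl))))
  expandDiag-step-diag (inL {L} {a} {R} {v} d) (node dL L<a dR R≤a) fresh eq =
    cong₂ (λ x z → x ++ a ∷ z)
      (expandDiag-step-diag d dL (LeftFresh-L {L} {a} {R} fresh) eq)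
      (expand-step R (NoLeft-R fresh (∈-++⁺ˡ (subst (_∈ word L) eq (label∈word v)))))

-- Only an ancestor with `v` in its left subtree can hide `v`, and its label is strictly larger,
-- hence above the threshold. So an insertion finds its place.
∈-expand : ∀ {T} (v : Node T) → Decreasing T → label v ∈ expand (label v) T
∈-expand (here {L} {a}) _ = ∈-++⁺ʳ (when (a <? a) (expand a L)) (here refl)
∈-expand (inL {L} {a} {R} v) (node dL L<a _ _) =
  subst (label v ∈_) (sym (expand-below L R (All.lookup L<a (label∈word v)))) (∈-++⁺ˡ (∈-expand v dL))
∈-expand (inR {L} {a} {R} v) (node _ _ dR _) =
  ∈-++⁺ʳ (when (label v <? a) (expand (label v) L)) (there (∈-expand v dR))

∈-expandDiag : ∀ {T} (v : Node T) → Decreasing T → label v ∈ expandDiag (label v) T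
∈-expandDiag (here {L} {a}) _ = ∈-++⁺ʳ (expandDiag a L) (here refl)
∈-expandDiag (inL v) (node dL _ _ _) = ∈-++⁺ˡ (∈-expandDiag v dL)
∈-expandDiag (inR {L} {a} {R} v) (node _ _ dR _) =
  ∈-++⁺ʳ (expandDiag (label v) L) (there (∈-expand v dR))

expand⊆word : ∀ {t b} T → b ∈ expand t T → b ∈ word T
expand⊆word {t} (node L a R) b∈ with t <? a
expand⊆word (node L a R) b∈ | yes _ with ∈-++⁻ (expand _ L) b∈
... | inj₁ b∈L         = ∈-++⁺ˡ (expand⊆word L b∈L)
... | inj₂ (here eq)   = ∈-++⁺ʳ (word L) (here eq)
... | inj₂ (there b∈R) = ∈-++⁺ʳ (word L) (there (expand⊆word R b∈R))
expand⊆word (node L a R) (here eq)   | no _ = ∈-++⁺ʳ (word L) (here eq)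
expand⊆word (node L a R) (there b∈R) | no _ = ∈-++⁺ʳ (word L) (there (expand⊆word R b∈R))

expandDiag⊆word : ∀ {t b} T → b ∈ expandDiag t T → b ∈ word T
expandDiag⊆word (node L a R) b∈ with ∈-++⁻ (expandDiag _ L) b∈
... | inj₁ b∈L         = ∈-++⁺ˡ (expandDiag⊆word L b∈L)
... | inj₂ (here eq)   = ∈-++⁺ʳ (word L) (here eq)
... | inj₂ (there b∈R) = ∈-++⁺ʳ (word L) (there (expand⊆word R b∈R))

module _ {t : ℕ} where

  -- The first node labeled suc t is the only one that starts to show its left
  -- subtree when the threshold drops to t; all labels there are at most t, so
  -- only the spine of that subtree appears.
  expand-insert : ∀ {T} (v : Node T) → Decreasing T → LeftFresh T →
    label v ≡ suc t → leftTree v ≢ empty →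
    expand t T ≡ insertBefore (suc t) (spine (leftTree v)) (expand (suc t) T)
  expand-insert (here {L} {a} {R}) (node dL L<a dR R≤a) fresh refl v≢ = begin
    expand t (node L (suc t) R)
      ≡⟨ expand-below L R ≤-refl ⟩
    expand t L ++ suc t ∷ expand t R
      ≡⟨ cong₂ (λ x z → x ++ suc t ∷ z) (expand-bounded L (All.map ≤-pred L<a))
           (expand-step R (NoLeft-R fresh (∈-++⁺ʳ (word L) (here refl)))) ⟩
    spine L ++ suc t ∷ expand (suc t) R
      ≡⟨ insertBefore-here (expand (suc t) R) ⟨
    insertBefore (suc t) (spine L) (suc t ∷ expand (suc t) R)
      ≡⟨ cong (insertBefore (suc t) (spine L)) (expand-above L R (<-irrefl {suc t} refl)) ⟨
    insertBefore (suc t) (spine L) (expand (suc t) (node L (suc t) R)) ∎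
    where open ≡-Reasoning
  expand-insert (inL {L} {a} {R} v) (node dL L<a dR R≤a) fresh eq v≢ = begin
    expand t (node L a R)
      ≡⟨ expand-below L R (<-trans (n<1+n t) j<a) ⟩
    expand t L ++ a ∷ expand t R
      ≡⟨ cong₂ (λ x z → x ++ a ∷ z) (expand-insert v dL (LeftFresh-L {L} {a} {R} fresh) eq v≢)
           (expand-step R (NoLeft-R fresh (∈-++⁺ˡ j∈L))) ⟩
    insertBefore (suc t) S (expand (suc t) L) ++ a ∷ expand (suc t) R
      -- The letter `suc t` is visible in the part from `L`, so the insertion ends there and leaves
      -- a and `R` alone.
      ≡⟨ insertBefore-++-∈ _ (subst (λ j → j ∈ expand j L) eq (∈-expand v dL)) ⟨
    insertBefore (suc t) S (expand (suc t) L ++ a ∷ expand (suc t) R)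
      ≡⟨ cong (insertBefore (suc t) S) (expand-below L R j<a) ⟨
    insertBefore (suc t) S (expand (suc t) (node L a R)) ∎
    where
    open ≡-Reasoning
    S   = spine (leftTree v)
    j∈L = subst (_∈ word L) eq (label∈word v)
    j<a = All.lookup L<a j∈L
  expand-insert (inR {L} {a} {R} v) (node dL L<a dR R≤a) fresh eq v≢ = begin
    expand t (node L a R)
      ≡⟨ cong (_++ a ∷ expand t R) prefix-step ⟩
    prefix ++ a ∷ expand t R
      ≡⟨ cong (λ z → prefix ++ a ∷ z) (expand-insert v dR (LeftFresh-R {L} {a} {R} fresh) eq v≢) ⟩
    prefix ++ a ∷ insertBefore (suc t) S (expand (suc t) R)
      ≡⟨ cong (prefix ++_) (insertBefore-++-∉ (a ∷ []) _ λ { (here j≡a) → a≢j (sym j≡a) }) ⟨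
    prefix ++ insertBefore (suc t) S (a ∷ expand (suc t) R)
      -- Freshness keeps `suc t` out of `L` and away from the root, so the insertion passes over
      -- both.
      ≡⟨ insertBefore-++-∉ prefix _ (j∉L ∘ prefix⊆L) ⟨
    insertBefore (suc t) S (expand (suc t) (node L a R)) ∎
    where
    open ≡-Reasoning
    S      = spine (leftTree v)
    prefix = when (suc t <? a) (expand (suc t) L)
    j∉     = subst (_∉ word L ++ a ∷ before v) eq (fresh (inR v) v≢)
    j∉L : suc t ∉ word L
    j∉L    = j∉ ∘ ∈-++⁺ˡ
    a≢j : a ≢ suc t
    a≢j refl = j∉ (∈-++⁺ʳ (word L) (here refl))
    prefix⊆L : ∀ {b} → b ∈ prefix → b ∈ word L
    prefix⊆L b∈ with suc t <? a
    ... | yes _ = expand⊆word L b∈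
    prefix-step : when (t <? a) (expand t L) ≡ prefix
    prefix-step with t <? a
    ... | yes t<a = trans (expand-step L (∉⇒NoLeft j∉L))
                          (sym (when-yes (suc t <? a) (<∧≢⇒1+< t<a a≢j)))
    ... | no t≮a  = sym (when-no (suc t <? a) (t≮a ∘ <-trans (n<1+n t)))

  -- The way to `v` follows the diagonal up to its first right turn, which `¬ Diag v` guarantees;
  -- from there on `expand-insert` applies.
  expandDiag-insert : ∀ {T} (v : Node T) → Decreasing T → LeftFresh T →
    ¬ Diag v → label v ≡ suc t → leftTree v ≢ empty →
    expandDiag t T ≡ insertBefore (suc t) (spine (leftTree v)) (expandDiag (suc t) T)
  expandDiag-insert here _ _ ¬d _ _ = contradiction here ¬d
  expandDiag-insert (inL {L} {a} {R} v) (node dL L<a dR R≤a) fresh ¬d eq v≢ = trans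
    (cong₂ (λ x z → x ++ a ∷ z)
      (expandDiag-insert v dL (LeftFresh-L {L} {a} {R} fresh) (¬d ∘ inL) eq v≢)
      (expand-step R (NoLeft-R fresh (∈-++⁺ˡ (subst (_∈ word L) eq (label∈word v))))))
    (sym (insertBefore-++-∈ _ (subst (λ j → j ∈ expandDiag j L) eq (∈-expandDiag v dL))))
  expandDiag-insert (inR {L} {a} {R} v) (node dL L<a dR R≤a) fresh ¬d eq v≢ = begin
    expandDiag t L ++ a ∷ expand t R
      ≡⟨ cong₂ (λ x z → x ++ a ∷ z) (expandDiag-step L (∉⇒NoLeft j∉L))
           (expand-insert v dR (LeftFresh-R {L} {a} {R} fresh) eq v≢) ⟩
    expandDiag (suc t) L ++ a ∷ insertBefore (suc t) S (expand (suc t) R)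
      ≡⟨ cong (expandDiag (suc t) L ++_)
           (insertBefore-++-∉ (a ∷ []) _ λ { (here j≡a) → a≢j (sym j≡a) }) ⟨
    expandDiag (suc t) L ++ insertBefore (suc t) S (a ∷ expand (suc t) R)
      ≡⟨ insertBefore-++-∉ (expandDiag (suc t) L) _ (j∉L ∘ expandDiag⊆word L) ⟨
    insertBefore (suc t) S (expandDiag (suc t) (node L a R)) ∎
    where
    open ≡-Reasoning
    S      = spine (leftTree v)
    j∉     = subst (_∉ word L ++ a ∷ before v) eq (fresh (inR v) v≢)
    j∉L : suc t ∉ word L
    j∉L    = j∉ ∘ ∈-++⁺ˡ
    a≢j : a ≢ suc t
    a≢j refl = j∉ (∈-++⁺ʳ (word L) (here refl))

  when-≤-step : ∀ a {x} → a ≢ suc t → when (a ≤? suc t) x ≡ when (a ≤? t) x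
  when-≤-step a a≢ with a ≤? t
  ... | yes a≤t = when-yes (a ≤? suc t) (m≤n⇒m≤1+n a≤t)
  ... | no a≰t  = when-no (a ≤? suc t) (λ a≤ → a≰t (≤-pred (≤∧≢⇒< a≤ a≢)))

  diagUpTo-step-∉ : ∀ T → suc t ∉ word T → diagUpTo (suc t) T ≡ diagUpTo t T
  diagUpTo-step-∉ empty        _  = refl
  diagUpTo-step-∉ (node L a R) j∉ = cong₂ _++_ (diagUpTo-step-∉ L (j∉ ∘ ∈-++⁺ˡ))
    (when-≤-step a λ { refl → j∉ (∈-++⁺ʳ (word L) (here refl)) })

  -- No diagonal node is labeled `suc t`: those above the right turn towards `v` have `v` on their
  -- left and so a larger label, and the turning node and all below it on the diagonal precede `v`.
  diagUpTo-step : ∀ {T} (v : Node T) → Decreasing T → ¬ Diag v →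
    label v ≡ suc t → label v ∉ before v → diagUpTo (suc t) T ≡ diagUpTo t T
  diagUpTo-step here _ ¬d _ _ = contradiction here ¬d
  diagUpTo-step (inL {L} {a} v) (node dL L<a _ _) ¬d eq j∉ =
    cong₂ _++_ (diagUpTo-step v dL (¬d ∘ inL) eq j∉)
      (when-≤-step a λ { refl → <-irrefl eq (All.lookup L<a (label∈word v)) })
  diagUpTo-step (inR {L} {a} v) _ ¬d eq fresh =
    cong₂ _++_ (diagUpTo-step-∉ L (j∉ ∘ ∈-++⁺ˡ))
      (when-≤-step a λ { refl → j∉ (∈-++⁺ʳ (word L) (here refl)) })
    where
    j∉ = subst (_∉ word L ++ a ∷ before v) eq fresh

  -- Labels increase strictly from the bottom of the diagonal to the top, so the block of `v` comes
  -- last and the nodes above `v` still contribute nothing.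
  diagUpTo-append : ∀ {T} {v : Node T} → Diag v → Decreasing T → label v ≡ suc t →
    diagUpTo (suc t) T ≡ diagUpTo t T ++ suc t ∷ spine (rightTree v)
  diagUpTo-append (here {L} {a} {R}) (node _ L<a _ _) refl = begin
    diagUpTo (suc t) L ++ when (suc t ≤? suc t) (suc t ∷ spine R)
      ≡⟨ cong₂ _++_ (diagUpTo-step-∉ L (<-irrefl refl ∘ All.lookup L<a))
           (when-yes (suc t ≤? suc t) ≤-refl) ⟩
    diagUpTo t L ++ suc t ∷ spine R
      ≡⟨ cong (_++ suc t ∷ spine R) (++-identityʳ (diagUpTo t L)) ⟨
    (diagUpTo t L ++ []) ++ suc t ∷ spine R
      ≡⟨ cong (λ z → (diagUpTo t L ++ z) ++ suc t ∷ spine R) (when-no (suc t ≤? t) (<-irrefl refl)) ⟨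
    (diagUpTo t L ++ when (suc t ≤? t) (suc t ∷ spine R)) ++ suc t ∷ spine R ∎
    where open ≡-Reasoning
  diagUpTo-append (inL {L} {a} {R} {v} d) (node dL L<a _ _) eq = begin
    diagUpTo (suc t) L ++ when (a ≤? suc t) _
      ≡⟨ cong₂ _++_ (diagUpTo-append d dL eq) (when-no (a ≤? suc t) (<⇒≱ j<a)) ⟩
    (diagUpTo t L ++ suc t ∷ spine (rightTree v)) ++ []
      ≡⟨ ++-identityʳ _ ⟩
    diagUpTo t L ++ suc t ∷ spine (rightTree v)
      ≡⟨ cong (_++ suc t ∷ spine (rightTree v)) (++-identityʳ (diagUpTo t L)) ⟨
    (diagUpTo t L ++ []) ++ suc t ∷ spine (rightTree v)
      ≡⟨ cong (λ z → (diagUpTo t L ++ z) ++ _) (when-no (a ≤? t) (<⇒≱ (<-trans (n<1+n t) j<a))) ⟨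
    (diagUpTo t L ++ when (a ≤? t) (a ∷ spine R)) ++ suc t ∷ spine (rightTree v) ∎
    where
    open ≡-Reasoning
    j<a = All.lookup L<a (subst (_∈ word L) eq (label∈word v))

-- The paths W_i

∈leftSpine⇒Diag : ∀ {T} {v : Node T} → v ∈ leftSpine T → Diag v
∈leftSpine⇒Diag {node L a R} (here refl) = here
∈leftSpine⇒Diag {node L a R} (there v∈) with u , u∈ , refl ← ∈-map⁻ inL v∈ = inL (∈leftSpine⇒Diag u∈)

Diag⇒∈leftSpine : ∀ {T} {v : Node T} → Diag v → v ∈ leftSpine T
Diag⇒∈leftSpine here    = here refl
Diag⇒∈leftSpine (inL d) = there (∈-map⁺ inL (Diag⇒∈leftSpine d))

head-map-++ : ∀ {A B : Set} (f : A → B) (xs : List A) (z : B) zs →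
  head (map f xs ++ z ∷ zs) ≡ just (maybe f z (head xs))
head-map-++ f []       z zs = refl
head-map-++ f (x ∷ xs) z zs = refl

-- The traversal starts at the bottom of the diagonal. Therefore an asctop off the diagonal has a
-- left child, and `asctopPath` does not fall back on `[]` there.
head-inorder⇒Diag : ∀ {T} {v : Node T} → head (inorder T) ≡ just v → Diag v
head-inorder⇒Diag {node L a R} eq
  with head (inorder L) in eqL | trans (sym (head-map-++ inL (inorder L) here (map inR (inorder R)))) eq
... | nothing | refl = here
... | just u  | refl = inL (head-inorder⇒Diag eqL)

word≡[]⇒empty : ∀ T → word T ≡ [] → T ≡ empty
word≡[]⇒empty empty        _  = refl
word≡[]⇒empty (node L a R) eq = contradiction (++-conicalʳ (word L) _ eq) λ ()

before≡[]⇒head : ∀ {T} (v : Node T) → before v ≡ [] → head (inorder T) ≡ just v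
before≡[]⇒head (here {L}) eq with refl ← word≡[]⇒empty L eq = refl
before≡[]⇒head (inL {L} {a} {R} v) eq =
  trans (head-map-++ inL (inorder L) here (map inR (inorder R)))
        (cong (just ∘ maybe inL here) (before≡[]⇒head v eq))
before≡[]⇒head (inR {L} v) eq = contradiction (++-conicalʳ (word L) _ eq) λ ()

-- v tops its right path even when its tree is hung as a right subtree; the
-- root of T does not.
record IsRightTop {T} (v : Node T) : Set where
  field
    rtop≡     : rtop v ≡ v
    rtop-inR≡ : ∀ {L a} → rtop (inR {L} {a} v) ≡ inR v

open IsRightTop

inL-rightTop : ∀ {L a R} {v : Node L} → rtop v ≡ v → IsRightTop (inL {L} {a} {R} v)
inL-rightTop eq .rtop≡     = cong inL eq
inL-rightTop eq .rtop-inR≡ = cong (inR ∘ inL) eq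

inR-rightTop : ∀ {L a R} {v : Node R} → IsRightTop v → IsRightTop (inR {L} {a} {R} v)
inR-rightTop top .rtop≡ = rtop-inR≡ top
inR-rightTop {L} {a} {v = v} top .rtop-inR≡ with rtop (inR {L} {a} v) | rtop-inR≡ top {L} {a}
... | _ | refl = refl

leftChild-rightTop : ∀ {T} (v : Node T) {c} → leftChild v ≡ just c → IsRightTop c
leftChild-rightTop (here {node _ _ _}) refl = inL-rightTop refl
leftChild-rightTop (inL v) eq with leftChild v in eqv
leftChild-rightTop (inL v) refl | just c = inL-rightTop (rtop≡ (leftChild-rightTop v eqv))
leftChild-rightTop (inR v) eq with leftChild v in eqv
leftChild-rightTop (inR v) refl | just c = inR-rightTop (leftChild-rightTop v eqv)

labels-inL : ∀ {L a R} (vs : List (Node L)) → map label (map (inL {L} {a} {R}) vs) ≡ map label vs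
labels-inL vs = sym (map-∘ vs)

labels-inR : ∀ {L a R} (vs : List (Node R)) → map label (map (inR {L} {a} {R}) vs) ≡ map label vs
labels-inR vs = sym (map-∘ vs)

labels-rightSpine : ∀ T → map label (rightSpine T) ≡ spine T
labels-rightSpine empty        = refl
labels-rightSpine (node L a R) = cong (a ∷_) (trans (labels-inR (rightSpine R)) (labels-rightSpine R))

leftChild-rightFrom : ∀ {T} (v : Node T) {c} → leftChild v ≡ just c →
  map label (rightFrom c) ≡ spine (leftTree v)
leftChild-rightFrom (here {L@(node _ _ _)}) refl =
  trans (labels-inL (rightSpine L)) (labels-rightSpine L)
leftChild-rightFrom (inL v) eq with leftChild v in eqv
leftChild-rightFrom (inL v) refl | just c = trans (labels-inL (rightFrom c)) (leftChild-rightFrom v eqv)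
leftChild-rightFrom (inR v) eq with leftChild v in eqv
leftChild-rightFrom (inR v) refl | just c = trans (labels-inR (rightFrom c)) (leftChild-rightFrom v eqv)

leftTree≢empty⇒leftChild : ∀ {T} (v : Node T) → leftTree v ≢ empty → Is-just (leftChild v)
leftTree≢empty⇒leftChild (here {empty})      v≢ = contradiction refl v≢
leftTree≢empty⇒leftChild (here {node _ _ _}) v≢ = just tt
leftTree≢empty⇒leftChild (inL v) v≢ with leftChild v | leftTree≢empty⇒leftChild v v≢
... | just _ | _ = just tt
leftTree≢empty⇒leftChild (inR v) v≢ with leftChild v | leftTree≢empty⇒leftChild v v≢
... | just _ | _ = just tt

leftChild⇒leftTree≢empty : ∀ {T} (v : Node T) {c} → leftChild v ≡ just c → leftTree v ≢ empty
leftChild⇒leftTree≢empty (here {node _ _ _}) _ ()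
leftChild⇒leftTree≢empty (inL v) eq with leftChild v in eqv
... | just _ = leftChild⇒leftTree≢empty v eqv
leftChild⇒leftTree≢empty (inR v) eq with leftChild v in eqv
... | just _ = leftChild⇒leftTree≢empty v eqv

Diag⇒rtop≡ : ∀ {T} {v : Node T} → Diag v → rtop v ≡ v
Diag⇒rtop≡ here    = refl
Diag⇒rtop≡ (inL d) = cong inL (Diag⇒rtop≡ d)

labels-rightFrom : ∀ {T} (v : Node T) → map label (rightFrom v) ≡ label v ∷ spine (rightTree v)
labels-rightFrom (here {L} {a} {R}) = labels-rightSpine (node L a R)
labels-rightFrom (inL v) = trans (labels-inL (rightFrom v)) (labels-rightFrom v)
labels-rightFrom (inR v) = trans (labels-inR (rightFrom v)) (labels-rightFrom v)

∈-inorder : ∀ {T} (v : Node T) → v ∈ inorder T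
∈-inorder (here {L})  = ∈-++⁺ʳ (map inL (inorder L)) (here refl)
∈-inorder (inL v)     = ∈-++⁺ˡ (∈-map⁺ inL (∈-inorder v))
∈-inorder (inR {L} v) = ∈-++⁺ʳ (map inL (inorder L)) (there (∈-map⁺ inR (∈-inorder v)))

find-complete : ∀ {A : Set} {P : A → Set} (P? : ∀ x → Dec (P x)) {x} xs → x ∈ xs → P x →
  ∃[ y ] (find P? xs ≡ just y × y ∈ xs × P y)
find-complete P? (z ∷ xs) x∈ px with P? z
... | yes pz = z , refl , here refl , pz
find-complete P? (z ∷ xs) (here refl) px | no ¬pz = contradiction px ¬pz
find-complete P? (z ∷ xs) (there x∈)  px | no ¬pz =
  let y , eq , y∈ , py = find-complete P? xs x∈ px in y , eq , there y∈ , py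

-- A block W_j, where v is the asctop labeled j; own is the case j ∈ W_j.
data BlockSpec (T : Tree) (j : ℕ) : List ℕ → Set where
  own : (v : Node T) → label v ≡ j → Diag v → BlockSpec T j (j ∷ spine (rightTree v))
  sub : (v : Node T) → label v ≡ j → ¬ Diag v → leftTree v ≢ empty →
        BlockSpec T j (spine (leftTree v))

asctopPath-spec : ∀ {T} (v : Node T) → IsAsctop v → BlockSpec T (label v) (map label (asctopPath v))
asctopPath-spec {T} v asc with _∈ⁿ?_ _≟ⁿ_ v (diag T)
... | yes v∈ rewrite Diag⇒rtop≡ (∈leftSpine⇒Diag v∈) | labels-rightFrom v =
  own v refl (∈leftSpine⇒Diag v∈)
... | no v∉ with leftChild v in eq | asc
...   | just c  | _ rewrite rtop≡ (leftChild-rightTop v eq) | leftChild-rightFrom v eq =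
  sub v refl (v∉ ∘ Diag⇒∈leftSpine) (leftChild⇒leftTree≢empty v eq)
...   | nothing | inj₁ first = contradiction (Diag⇒∈leftSpine (head-inorder⇒Diag first)) v∉

W-spec : ∀ {T} (v : Node T) → IsAsctop v → BlockSpec T (label v) (map label (W T (label v)))
W-spec {T} v asc
  with find-complete (λ u → label u ≟ label v) (asctops T) (∈-filter⁺ isAsctop? (∈-inorder v) asc) refl
-- The search may return a node `u` other than `v`; the block is then described from `u`, which has
-- the same label.
... | u , found , u∈ , eq rewrite found =
  subst (λ j → BlockSpec T j _) eq (asctopPath-spec u (proj₂ (∈-filter⁻ isAsctop? {xs = inorder T} u∈)))

subtree-decreasing : ∀ {T} (v : Node T) → Decreasing T →
  Decreasing (node (leftTree v) (label v) (rightTree v))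
subtree-decreasing here    d              = d
subtree-decreasing (inL v) (node dL _ _ _) = subtree-decreasing v dL
subtree-decreasing (inR v) (node _ _ dR _) = subtree-decreasing v dR

-- α recovers the word of a tree

-- A multiset has only one weakly decreasing listing. Right paths of a decreasing tree are such
-- listings, so sorting a block returns the path itself.
↓-unique : ∀ {xs ys} → xs ↭ ys → AllPairs _≥_ ys → ↓ xs ≡ ys
↓-unique {xs} xs↭ys ys↘ = Pointwise-≡⇒≡ (↗↭↗⇒≋ (DTO.≥-totalOrder ≤-decTotalOrder)
  (sort-↗ xs) (AllPairs⇒Sorted (DTO.≥-totalOrder ≤-decTotalOrder) ys↘)
  (↭⇒↭ₛ (↭-trans (sort-↭ xs) xs↭ys)))

module _ {A : Set} {P : A → Set} (P? : ∀ a → Dec (P a)) where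

  -- Telescoping: `s t` is the intended word after the first t indices, so only the effect of a
  -- single index has to be known. The general `f` lets the induction shift the indices.
  concatMap-filter-tabulate : ∀ (b : A → List ℕ) {n} (f : Fin n → A) (s : ℕ → List ℕ) →
    (∀ i → P (f i) → s (suc (toℕ i)) ≡ s (toℕ i) ++ b (f i)) →
    (∀ i → ¬ P (f i) → s (suc (toℕ i)) ≡ s (toℕ i)) →
    s 0 ++ concatMap b (filter P? (List.tabulate f)) ≡ s n
  concatMap-filter-tabulate b {zero}  f s add skip = ++-identityʳ (s 0)
  concatMap-filter-tabulate b {suc n} f s add skip
    with P? (f zero) | concatMap-filter-tabulate b (f ∘ suc) (s ∘ suc) (add ∘ suc) (skip ∘ suc)
  ... | yes p | ih = trans (sym (++-assoc (s 0) (b (f zero)) _))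
                           (trans (cong (_++ _) (sym (add zero p))) ih)
  ... | no ¬p | ih = trans (cong (_++ _) (sym (skip zero ¬p))) ih

  -- The same telescoping from the top down: a right fold treats the largest index first, in the
  -- order of the block insertion.
  foldr-filter-tabulate : ∀ {X : Set} (step : A → X → X) {n} (f : Fin n → A) (s : ℕ → X) →
    (∀ i → P (f i) → s (toℕ i) ≡ step (f i) (s (suc (toℕ i)))) →
    (∀ i → ¬ P (f i) → s (toℕ i) ≡ s (suc (toℕ i))) →
    foldr step (s n) (filter P? (List.tabulate f)) ≡ s 0
  foldr-filter-tabulate step {zero}  f s add skip = refl
  foldr-filter-tabulate step {suc n} f s add skip
    with P? (f zero) | foldr-filter-tabulate step (f ∘ suc) (s ∘ suc) (add ∘ suc) (skip ∘ suc)
  ... | yes p | ih = trans (cong (step (f zero)) ih) (sym (add zero p))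
  ... | no ¬p | ih = trans ih (sym (skip zero ¬p))

module _ {T : Tree} (d : Decreasing T) (fresh : LeftFresh T) where

  block-decreasing : ∀ {j B} → BlockSpec T j B → AllPairs _≥_ B
  block-decreasing (own v refl _) with subtree-decreasing v d
  ... | node _ _ dR R≤ = spine-decreasing (node empty [] dR R≤)
  block-decreasing (sub v refl _ _) with subtree-decreasing v d
  ... | node dL _ _ _ = spine-decreasing dL

  -- Strict decrease to the left. As a consequence the test `j ∈ B` made by `α` detects whether the
  -- asctop lies on the diagonal.
  sub-∉ : ∀ v → label v ∉ spine (leftTree v)
  sub-∉ v v∈ with subtree-decreasing v d
  ... | node _ L< _ _ = <-irrefl refl (All.lookup L< (spine⊆word (leftTree v) v∈))

  diagUpTo-own : ∀ {t B} → BlockSpec T (suc t) B → suc t ∈ B →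
    diagUpTo (suc t) T ≡ diagUpTo t T ++ B
  diagUpTo-own (own v eq dv)   _  = diagUpTo-append dv d eq
  diagUpTo-own (sub v eq _ _) j∈ = contradiction (subst (_∈ spine (leftTree v)) (sym eq) j∈) (sub-∉ v)

  diagUpTo-sub : ∀ {t B} → BlockSpec T (suc t) B → suc t ∉ B → diagUpTo (suc t) T ≡ diagUpTo t T
  diagUpTo-sub (own v eq dv)     j∉ = contradiction (here refl) j∉
  diagUpTo-sub (sub v eq ¬dv v≢) _  = diagUpTo-step v d ¬dv eq (fresh v v≢)

  expandDiag-own : ∀ {t B} → BlockSpec T (suc t) B → suc t ∈ B →
    expandDiag t T ≡ expandDiag (suc t) T
  expandDiag-own (own v eq dv)   _  = expandDiag-step-diag dv d fresh eq
  expandDiag-own (sub v eq _ _) j∈ = contradiction (subst (_∈ spine (leftTree v)) (sym eq) j∈) (sub-∉ v)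

  expandDiag-sub : ∀ {t B} → BlockSpec T (suc t) B → suc t ∉ B →
    expandDiag t T ≡ insertBefore (suc t) B (expandDiag (suc t) T)
  expandDiag-sub (own v eq dv)     j∉ = contradiction (here refl) j∉
  expandDiag-sub (sub v eq ¬dv v≢) _  = expandDiag-insert v d fresh ¬dv eq v≢

  module _ {k : ℕ} (P : Vec Multiset k) (B : Fin k → Multiset)
           (spec : ∀ i → BlockSpec T (index i) (B i)) (P↭B : ∀ i → lookup P i ↭ B i) where

    private
      ↓P≡B : ∀ i → ↓ (lookup P i) ≡ B i
      ↓P≡B i = ↓-unique (P↭B i) (block-decreasing (spec i))

    α-word : All (1 ≤_) (word T) → All (_≤ k) (word T) → α (mkCover k P) ≡ word T
    α-word pos T≤k = begin
      α (mkCover k P)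
        ≡⟨ reverse-foldl (λ x i → insert i x) start inserted ⟩
      foldr insert start inserted
        ≡⟨ cong (λ z → foldr insert z inserted) start≡ ⟩
      foldr insert (expandDiag k T) inserted
        ≡⟨ foldr-filter-tabulate (λ i → ¬? (own? i)) insert (λ i → i) (λ t → expandDiag t T)
             (λ i i∉ → trans (expandDiag-sub (spec i) (i∉ ∘ ∈-resp-↭ (↭-sym (P↭B i))))
               (cong (λ b → insertBefore (index i) b (expandDiag (index i) T)) (sym (↓P≡B i))))
             (λ i ¬¬i → expandDiag-own (spec i) (∈-resp-↭ (P↭B i) (decidable-stable (own? i) ¬¬i))) ⟩
      expandDiag 0 T
        ≡⟨ expandDiag-0 T pos ⟩
      word T ∎
      where
      open ≡-Reasoning
      sorted : Fin k → List ℕ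
      sorted i = ↓ (lookup P i)
      insert : Fin k → List ℕ → List ℕ
      insert i = insertBefore (index i) (sorted i)
      own? : (i : Fin k) → Dec (index i ∈ lookup P i)
      own? i = index i ∈? lookup P i
      start : List ℕ
      start = concatMap sorted (filter own? (allFin k))
      inserted : List (Fin k)
      inserted = filter (λ i → ¬? (own? i)) (allFin k)
      start≡ : start ≡ expandDiag k T
      start≡ = begin
        start
          ≡⟨ cong (_++ start) (diagUpTo-0 T pos) ⟨
        diagUpTo 0 T ++ start
          ≡⟨ concatMap-filter-tabulate own? sorted (λ i → i) (λ t → diagUpTo t T)
               (λ i i∈ → trans (diagUpTo-own (spec i) (∈-resp-↭ (P↭B i) i∈))
                 (cong (diagUpTo (toℕ i) T ++_) (sym (↓P≡B i))))
               (λ i i∉ → diagUpTo-sub (spec i) (i∉ ∘ ∈-resp-↭ (↭-sym (P↭B i)))) ⟩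
        diagUpTo k T
          ≡⟨ diagUpTo-bounded T T≤k ⟩
        expandDiag k T ∎

-- Multisets with equal multiplicities

count : ℕ → List ℕ → ℕ
count j xs = length (filter (_≟ j) xs)

count-∷-injective : ∀ {j} x xs ys → count j (x ∷ xs) ≡ count j (x ∷ ys) → count j xs ≡ count j ys
-- `filter` branches on the Boolean part of `x ≟ j`, which computes to `x ≡ᵇ j`.
count-∷-injective {j} x xs ys eq with x ≡ᵇ j
... | true  = suc-injective eq
... | false = eq

count-self : ∀ x xs → count x (x ∷ xs) ≡ suc (count x xs)
count-self x xs = cong length (filter-accept (_≟ x) refl)

count≡suc⇒∈ : ∀ {j n} xs → count j xs ≡ suc n → j ∈ xs
count≡suc⇒∈ {j} xs eq with filter (_≟ j) xs in filter≡
... | z ∷ zs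
  with z∈ , refl ← ∈-filter⁻ (_≟ j) {xs = xs} (subst (z ∈_) (sym filter≡) (here refl)) = z∈

count-∉ : ∀ {j xs} → j ∉ xs → count j xs ≡ 0
count-∉ {j} {xs} j∉ =
  cong length (filter-none (_≟ j) (All.tabulate λ { x∈ refl → j∉ x∈ }))

count-++ : ∀ j xs ys → count j (xs ++ ys) ≡ count j xs + count j ys
count-++ j xs ys = trans (cong length (filter-++ (_≟ j) xs ys)) (length-++ (filter (_≟ j) xs))

count-map-label : ∀ {T} j (vs : List (Node T)) →
  count j (map label vs) ≡ length (filter (λ v → label v ≟ j) vs)
count-map-label j []       = refl
count-map-label j (v ∷ vs) with label v ≡ᵇ j
... | true  = cong suc (count-map-label j vs)
... | false = count-map-label j vs

count-≡⇒↭ : ∀ xs ys → (∀ j → count j xs ≡ count j ys) → xs ↭ ys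
count-≡⇒↭ []       []       _  = _↭_.refl
count-≡⇒↭ []       (y ∷ ys) eq with () ← trans (eq y) (count-self y ys)
count-≡⇒↭ (x ∷ xs) ys       eq
  with as , bs , refl ← ∈-∃++ (count≡suc⇒∈ ys (trans (sym (eq x)) (count-self x xs))) =
  ↭-trans (_↭_.prep x (count-≡⇒↭ xs (as ++ bs) λ j → count-∷-injective x xs (as ++ bs)
            (trans (eq j) (↭-length (filter-↭ (_≟ j) (shift x as bs))))))
          (↭-sym (shift x as bs))

-- Labels of covers and sums

∈word⇒≤maxLabel : ∀ {b} T → b ∈ word T → b ≤ maxLabel T
∈word⇒≤maxLabel (node L a R) b∈ with ∈-++⁻ (word L) b∈
... | inj₁ b∈L         = ≤-trans (∈word⇒≤maxLabel L b∈L) (≤-trans (m≤m⊔n _ _) (m≤n⊔m a _))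
... | inj₂ (here refl) = m≤m⊔n a _
... | inj₂ (there b∈R) = ≤-trans (∈word⇒≤maxLabel R b∈R) (≤-trans (m≤n⊔m _ _) (m≤n⊔m a _))

maxLabel∈word : ∀ T → maxLabel T ≡ 0 ⊎ maxLabel T ∈ word T
maxLabel∈word empty = inj₁ refl
maxLabel∈word (node L a R) with ⊔-sel a (maxLabel L ⊔ maxLabel R)
... | inj₁ eq = inj₂ (subst (_∈ word L ++ a ∷ word R) (sym eq) (∈-++⁺ʳ (word L) (here refl)))
... | inj₂ eq with ⊔-sel (maxLabel L) (maxLabel R)
...   | inj₁ eqL with maxLabel∈word L
...     | inj₁ ≡0 = inj₁ (trans eq (trans eqL ≡0))
...     | inj₂ ∈L = inj₂ (subst (_∈ word L ++ a ∷ word R) (sym (trans eq eqL)) (∈-++⁺ˡ ∈L))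
maxLabel∈word (node L a R) | inj₂ eq | inj₂ eqR with maxLabel∈word R
...     | inj₁ ≡0 = inj₁ (trans eq (trans eqR ≡0))
...     | inj₂ ∈R = inj₂ (subst (_∈ word L ++ a ∷ word R) (sym (trans eq eqR)) (∈-++⁺ʳ (word L) (there ∈R)))

labels⊆word : ∀ {T b} (vs : List (Node T)) → b ∈ map label vs → b ∈ word T
labels⊆word vs b∈ with v , _ , refl ← ∈-map⁻ label b∈ = label∈word v

at-tabulate : ∀ {A : Set} {n} {f : Fin n → A} i {z} → z ≡ lookup (Vec.tabulate f) i → z ≡ f i
at-tabulate {f = f} i eq = trans eq (Vecₚ.lookup∘tabulate f i)

module _ {p k} (P : Vec Multiset p) (P′ : Vec Multiset k) where

  +ᶜ-∈ : ∀ i {b} → b ∈ lookup (blocks (mkCover p P +ᶜ mkCover k P′)) i →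
    (∃[ i′ ] b ∈ lookup P i′) ⊎ b ∈ lookup P′ i
  +ᶜ-∈ i b∈ with toℕ i <? p | subst (_ ∈_) (Vecₚ.lookup∘tabulate _ i) b∈
  ... | no _    | b∈′ = inj₂ b∈′
  ... | yes i<p | b∈′ with ∈-++⁻ (lookup P (fromℕ< i<p)) b∈′
  ...   | inj₁ b∈P  = inj₁ (_ , b∈P)
  ...   | inj₂ b∈P′ = inj₂ b∈P′

  -- For i ≤ p < j the cover sum adds the whole block B_i while the matrix sum keeps a′ alone. They
  -- agree because B_i has no label above p.
  count-+ᶜ : (A : Vec (Vec ℕ p) p) (A′ : Vec (Vec ℕ k) k) →
    (∀ i {b} → b ∈ lookup P i → b ≤ p) →
    (∀ i j → count (index j) (lookup P i) ≡ lookup (lookup A i) j) →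
    (∀ i j → count (index j) (lookup P′ i) ≡ lookup (lookup A′ i) j) →
    ∀ i j → count (index j) (lookup (blocks (mkCover p P +ᶜ mkCover k P′)) i) ≡
            lookup (lookup (entries (mkMatrix p A +ᴹ mkMatrix k A′)) i) j
  count-+ᶜ A A′ P≤p cP cP′ i j
    -- The local functions of the two sums cannot be named here; abstracting the unfolded entries
    -- together with both tests lets each case compute them.
    with toℕ i <? p | toℕ j <? p
       | at-tabulate i {z = lookup (blocks (mkCover p P +ᶜ mkCover k P′)) i} refl
       | at-tabulate j (cong (λ r → lookup r j)
           (at-tabulate i {z = lookup (entries (mkMatrix p A +ᴹ mkMatrix k A′)) i} refl))
  ... | no _    | _       | block≡ | entry≡ =
    trans (cong (count (index j)) block≡) (trans (cP′ i j) (sym entry≡))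
  ... | yes i<p | yes j<p | block≡ | entry≡ =
    trans (cong (count (index j)) block≡)
      (trans (count-++ (index j) (lookup P (fromℕ< i<p)) (lookup P′ i))
        (trans (cong₂ _+_
          (trans (cong (λ n → count (suc n) (lookup P (fromℕ< i<p))) (sym (toℕ-fromℕ< j<p)))
                 (cP (fromℕ< i<p) (fromℕ< j<p)))
          (cP′ i j)) (sym entry≡)))
  ... | yes i<p | no j≮p  | block≡ | entry≡ =
    trans (cong (count (index j)) block≡)
      (trans (count-++ (index j) (lookup P (fromℕ< i<p)) (lookup P′ i))
        (trans (cong₂ _+_ (count-∉ (j≮p ∘ P≤p (fromℕ< i<p))) (cP′ i j)) (sym entry≡)))

-- The two dimensions are only propositionally equal, so indices are compared through `toℕ`.
entries-cong : ∀ {M N} → M ≡ N → ∀ (i j : Fin (dim M)) (i′ j′ : Fin (dim N)) →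
  toℕ i ≡ toℕ i′ → toℕ j ≡ toℕ j′ →
  lookup (lookup (entries M) i) j ≡ lookup (lookup (entries N) i′) j′
entries-cong refl i j i′ j′ i≡ j≡ rewrite toℕ-injective i≡ | toℕ-injective j≡ = refl

lookup-𝔓 : ∀ T i → lookup (blocks (𝔓 T)) i ≡ map label (W T (index i))
lookup-𝔓 T i = Vecₚ.lookup∘tabulate _ i

𝔓⊆word : ∀ T i {b} → b ∈ lookup (blocks (𝔓 T)) i → b ∈ word T
𝔓⊆word T i b∈ = labels⊆word (W T (index i)) (subst (_ ∈_) (lookup-𝔓 T i) b∈)

count-W : ∀ T (i j : Fin (maxLabel T)) →
  count (index j) (map label (W T (index i))) ≡ lookup (lookup (entries (β T)) i) j
count-W T i j = trans (count-map-label (index j) (W T (index i)))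
  (sym (trans (cong (λ r → lookup r j) (Vecₚ.lookup∘tabulate _ i)) (Vecₚ.lookup∘tabulate _ j)))

count-𝔓 : ∀ T i j → count (index j) (lookup (blocks (𝔓 T)) i) ≡ lookup (lookup (entries (β T)) i) j
count-𝔓 T i j = trans (cong (count (index j)) (lookup-𝔓 T i)) (count-W T i j)

in-range : ∀ {k b} → 1 ≤ b → b ≤ k → ∃[ j ] index {k} j ≡ b
in-range {b = suc b} _ b<k = fromℕ< b<k , cong suc (toℕ-fromℕ< b<k)

-- A matrix row records the multiplicities of 1, ..., k only; the range hypotheses make all others
-- zero.
bounded-count-≡⇒↭ : ∀ {k} xs ys →
  (∀ {b} → b ∈ xs → 1 ≤ b × b ≤ k) → (∀ {b} → b ∈ ys → 1 ≤ b × b ≤ k) →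
  (∀ (j : Fin k) → count (index j) xs ≡ count (index j) ys) → xs ↭ ys
bounded-count-≡⇒↭ {k} xs ys xs-in ys-in eq = count-≡⇒↭ xs ys everywhere
  where
  everywhere : ∀ b → count b xs ≡ count b ys
  everywhere b with 1 ≤? b | b ≤? k
  ... | yes 1≤b | yes b≤k with j , refl ← in-range 1≤b b≤k = eq j
  ... | no ¬1≤b | _ = trans (count-∉ (¬1≤b ∘ proj₁ ∘ xs-in)) (sym (count-∉ (¬1≤b ∘ proj₁ ∘ ys-in)))
  ... | yes _ | no ¬b≤k = trans (count-∉ (¬b≤k ∘ proj₂ ∘ xs-in)) (sym (count-∉ (¬b≤k ∘ proj₂ ∘ ys-in)))

module _ {S T T′ : Tree} (p≤k : maxLabel T ≤ maxLabel T′) (β≡ : β S ≡ β T +ᴹ β T′)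
         (posS : All (1 ≤_) (word S)) (posT : All (1 ≤_) (word T))
         (posT′ : All (1 ≤_) (word T′)) where

  private
    k≡ : maxLabel S ≡ maxLabel T′
    k≡ = cong dim β≡

  -- The tree `S` is tied to the sum only through its matrix, so the two blocks are compared by
  -- multiplicities, which both sides read off row i.
  sum-blocks : ∀ i → lookup (blocks (𝔓 T +ᶜ 𝔓 T′)) i ↭ map label (W S (index i))
  sum-blocks i = bounded-count-≡⇒↭ {maxLabel T′} _ _ left right λ j → begin
    count (index j) (lookup (blocks (𝔓 T +ᶜ 𝔓 T′)) i)
      ≡⟨ count-+ᶜ (blocks (𝔓 T)) (blocks (𝔓 T′)) (entries (β T)) (entries (β T′))
           (λ i → ∈word⇒≤maxLabel T ∘ 𝔓⊆word T i) (count-𝔓 T) (count-𝔓 T′) i j ⟩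
    lookup (lookup (entries (β T +ᴹ β T′)) i) j
      ≡⟨ entries-cong β≡ (back i) (back j) i j (toℕ-cast _ i) (toℕ-cast _ j) ⟨
    lookup (lookup (entries (β S)) (back i)) (back j)
      ≡⟨ count-W S (back i) (back j) ⟨
    count (index (back j)) (map label (W S (index (back i))))
      ≡⟨ cong₂ (λ b c → count (suc b) (map label (W S (suc c)))) (toℕ-cast _ j) (toℕ-cast _ i) ⟩
    count (index j) (map label (W S (index i))) ∎
    where
    open ≡-Reasoning
    back : Fin (maxLabel T′) → Fin (maxLabel S)
    back = Fin.cast (sym k≡)
    left : ∀ {b} → b ∈ lookup (blocks (𝔓 T +ᶜ 𝔓 T′)) i → 1 ≤ b × b ≤ maxLabel T′
    left b∈ with +ᶜ-∈ (blocks (𝔓 T)) (blocks (𝔓 T′)) i b∈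
    ... | inj₁ (i′ , b∈T) =
      All.lookup posT (𝔓⊆word T i′ b∈T) ,
      ≤-trans (∈word⇒≤maxLabel T (𝔓⊆word T i′ b∈T)) p≤k
    ... | inj₂ b∈T′ =
      All.lookup posT′ (𝔓⊆word T′ i b∈T′) , ∈word⇒≤maxLabel T′ (𝔓⊆word T′ i b∈T′)
    right : ∀ {b} → b ∈ map label (W S (index i)) → 1 ≤ b × b ≤ maxLabel T′
    right b∈ = let b∈S = labels⊆word (W S (index i)) b∈ in
      All.lookup posS b∈S , ≤-trans (∈word⇒≤maxLabel S b∈S) (≤-reflexive k≡)

-- The tree of a word

splitMax-++ : ∀ a x → let u , m , w = splitMax a x in u ++ m ∷ w ≡ a ∷ x
splitMax-++ a []      = refl
splitMax-++ a (b ∷ x) with splitMax b x | splitMax-++ b x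
... | u , m , w | eq with m ≤? a
...   | yes _ = refl
...   | no  _ = cong (a ∷_) eq

-- Ties go to the earlier letter, which keeps the bound on the left strict.
splitMax-max : ∀ a x → let u , m , w = splitMax a x in All (_< m) u × All (_≤ m) w
splitMax-max a []      = [] , []
splitMax-max a (b ∷ x) with splitMax b x | splitMax-++ b x | splitMax-max b x
... | u , m , w | eq | u<m , w≤m with m ≤? a
...   | yes m≤a = [] , subst (All (_≤ a)) eq
  (Allₚ.++⁺ (All.map (λ c<m → ≤-trans (<⇒≤ c<m) m≤a) u<m)
            (m≤a ∷ All.map (λ c≤m → ≤-trans c≤m m≤a) w≤m))
...   | no m≰a = ≰⇒> m≰a ∷ u<m , w≤m

word-ᾱ-acc : ∀ x ac → word (ᾱ-acc x ac) ≡ x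
word-ᾱ-acc []      _        = refl
word-ᾱ-acc (a ∷ x) (acc rs) = trans
  (cong₂ (λ u w → u ++ proj₁ (proj₂ (splitMax a x)) ∷ w) (word-ᾱ-acc _ _) (word-ᾱ-acc _ _))
  (splitMax-++ a x)

ᾱ-acc-decreasing : ∀ x ac → Decreasing (ᾱ-acc x ac)
ᾱ-acc-decreasing []      _        = empty
ᾱ-acc-decreasing (a ∷ x) (acc rs) with splitMax-max a x
... | u<m , w≤m = node
  (ᾱ-acc-decreasing _ _) (subst (All _) (sym (word-ᾱ-acc _ _)) u<m)
  (ᾱ-acc-decreasing _ _) (subst (All _) (sym (word-ᾱ-acc _ _)) w≤m)

-- Modified ascent sequences

pos : ∀ (u : List ℕ) {b w} → Fin (length (u ++ b ∷ w))
pos []      = zero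
pos (_ ∷ u) = suc (pos u)

toℕ-pos : ∀ (u : List ℕ) {b w} → toℕ (pos u {b} {w}) ≡ length u
toℕ-pos []      = refl
toℕ-pos (_ ∷ u) = cong suc (toℕ-pos u)

lookup-pos : ∀ (u : List ℕ) {b w} → List.lookup (u ++ b ∷ w) (pos u) ≡ b
lookup-pos []      = refl
lookup-pos (_ ∷ u) = lookup-pos u

∈⇒lookup : ∀ {u z : List ℕ} {b} → b ∈ u → ∃[ h ] (List.lookup (u ++ z) h ≡ b × toℕ h < length u)
∈⇒lookup (here refl) = zero , refl , s≤s z≤n
∈⇒lookup (there b∈) with h , eq , h< ← ∈⇒lookup b∈ = suc h , eq , s≤s h<

lookup∈prefix : ∀ (u : List ℕ) {z} h → toℕ h < length u → List.lookup (u ++ z) h ∈ u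
lookup∈prefix (a ∷ u) zero    _        = here refl
lookup∈prefix (a ∷ u) (suc h) (s≤s h<) = there (lookup∈prefix u h h<)

last-pos : ∀ (u : List ℕ) {a z} →
  ∃[ h ] (List.lookup ((u ++ a ∷ []) ++ z) h ≡ a × suc (toℕ h) ≡ length (u ++ a ∷ []))
last-pos []      = zero , refl , refl
last-pos (_ ∷ u) with h , eq , h≡ ← last-pos u = suc h , eq , cong suc h≡

∈⇒≤maxʷ : ∀ {b x} → b ∈ x → b ≤ maxʷ x
∈⇒≤maxʷ {x = a ∷ x} (here refl) = m≤m⊔n a _
∈⇒≤maxʷ {x = a ∷ x} (there b∈)  = ≤-trans (∈⇒≤maxʷ b∈) (m≤n⊔m a _)

IsCayley⇒positive : ∀ {x} → IsCayley x → All (1 ≤_) x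
IsCayley⇒positive (_ , values) = All.tabulate (proj₁ ∘ Equivalence.to (values _))

module _ {u : List ℕ} {a b w} (mod : IsModifiedAscent ((u ++ a ∷ []) ++ b ∷ w)) where

  private
    v : List ℕ
    v = u ++ a ∷ []

    y : List ℕ
    y = v ++ b ∷ w

  ascent⇒fresh : a < b → b ∉ v
  ascent⇒fresh a<b b∈ =
    let h , h≡b , h< = ∈⇒lookup {z = b ∷ w} b∈
        l , l≡a , l≡ = last-pos u {a} {b ∷ w}
        _ , _ , leftmost-b = proj₁ (proj₂ mod)
          (lookup-pos v , inj₂ (l , trans l≡ (sym (toℕ-pos v)) ,
           subst₂ _<_ (sym l≡a) (sym (lookup-pos v)) a<b))
    in <⇒≱ h< (subst (_≤ toℕ h) (toℕ-pos v) (leftmost-b h h≡b))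

  fresh⇒nub : b ∉ v → nubʷ y (pos v , b)
  fresh⇒nub b∉ = (All.lookup (IsCayley⇒positive (proj₁ mod)) b∈y , ∈⇒≤maxʷ b∈y) , lookup-pos v ,
    λ h h≡b → subst (_≤ toℕ h) (sym (toℕ-pos v))
      (≮⇒≥ λ h< → b∉ (subst (_∈ v) h≡b (lookup∈prefix v h h<)))
    where
    b∈y : b ∈ y
    b∈y = ∈-++⁺ʳ v (here refl)

  -- Uses the inclusion of nub in asctops; `ascent⇒fresh` uses the converse one. Position 0 is ruled
  -- out because a precedes b.
  fresh⇒ascent : b ∉ v → a < b
  fresh⇒ascent b∉ with proj₂ (proj₂ (proj₂ mod) (fresh⇒nub b∉))
  ... | inj₁ ≡0 = contradiction (++-conicalʳ u (a ∷ []) (length≡0 (trans (sym (toℕ-pos v)) ≡0))) λ ()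
    where
    length≡0 : ∀ {x : List ℕ} → length x ≡ 0 → x ≡ []
    length≡0 {[]} _ = refl
  ... | inj₂ (h , h≡ , h<) with l , l≡a , l≡ ← last-pos u {a} {b ∷ w} =
    subst₂ _<_ (trans (cong (List.lookup y) h≡l) l≡a) (lookup-pos v) h<
    where
    h≡l : h ≡ l
    h≡l = toℕ-injective (suc-injective (trans h≡ (trans (toℕ-pos v) (sym l≡))))

-- Trees whose in-order word is a modified ascent sequence

before-leftTree : ∀ {T} (v : Node T) → ∃[ c ] before v ≡ c ++ word (leftTree v)
before-leftTree here    = [] , refl
before-leftTree (inL v) = before-leftTree v
before-leftTree (inR {L} {a} v) with c , eq ← before-leftTree v =
  word L ++ a ∷ c , trans (cong (λ z → word L ++ a ∷ z) eq) (sym (++-assoc (word L) (a ∷ c) _))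

-- Without a left subtree, the in-order predecessor of `v` is an ancestor that has `v` in its right
-- subtree, so no ascent ends at `v`.
before-last : ∀ {T} (v : Node T) → Decreasing T → leftTree v ≡ empty →
  ∀ u {a} → before v ≡ u ++ a ∷ [] → label v ≤ a
before-last here _ refl u eq = contradiction (++-conicalʳ u _ (sym eq)) λ ()
before-last (inL v) (node dL _ _ _) ≡e u eq = before-last v dL ≡e u eq
before-last (inR {L} {b} v) (node _ _ dR R≤b) ≡e u {a} eq
  with before v | initLast (before v) | before-last v dR ≡e
... | _ | []       | _  = ≤-trans (All.lookup R≤b (label∈word v))
  (≤-reflexive (∷ʳ-injectiveʳ (word L) u eq))
... | _ | u′ ∷ʳ′ c | ih = ≤-trans (ih u′ refl)
  (≤-reflexive (∷ʳ-injectiveʳ (word L ++ b ∷ u′) u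
    (trans (++-assoc (word L) (b ∷ u′) (c ∷ [])) eq)))

module _ {T : Tree} (d : Decreasing T) (mod : IsModifiedAscent (word T)) where

  private
    split : ∀ (v : Node T) {u a} → before v ≡ u ++ a ∷ [] →
      IsModifiedAscent ((u ++ a ∷ []) ++ label v ∷ after v)
    split v eq = subst IsModifiedAscent (trans (word-split v) (cong (_++ label v ∷ after v) eq)) mod

  -- The letter just before `v` is the last one of its left subtree and is smaller than `label v`.
  -- So `v` is an ascent top and thus a first occurrence.
  leftFresh : LeftFresh T
  leftFresh v v≢ v∈ with c , eq ← before-leftTree v
    with word (leftTree v) in eqw | initLast (word (leftTree v)) | subtree-decreasing v d
  ... | _ | []      | _ = v≢ (word≡[]⇒empty (leftTree v) eqw)
  ... | _ | u ∷ʳ′ a | node _ L< _ _ =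
    ascent⇒fresh {c ++ u} (split v before≡)
      (All.lookup L< (subst (a ∈_) (sym eqw) (∈-++⁺ʳ u (here refl))))
      (subst (label v ∈_) before≡ v∈)
    where
    before≡ : before v ≡ (c ++ u) ++ a ∷ []
    before≡ = trans eq (sym (++-assoc c u (a ∷ [])))

  -- A first occurrence that is not the first letter ends an ascent, which `before-last` excludes
  -- for a node without left subtree.
  leftmost-isAsctop : ∀ (v : Node T) → label v ∉ before v → IsAsctop v
  leftmost-isAsctop v v∉ with empty? (leftTree v)
  ... | inj₂ v≢ = inj₂ (leftTree≢empty⇒leftChild v v≢)
  ... | inj₁ ≡e with before v in eq | initLast (before v)
  ...   | _ | []      = inj₁ (before≡[]⇒head v eq)
  ...   | _ | u ∷ʳ′ a = contradiction (before-last v d ≡e u eq)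
          (<⇒≱ (fresh⇒ascent {u} (split v eq) v∉))

  index∈word : ∀ {j} → 1 ≤ j → j ≤ maxLabel T → j ∈ word T
  index∈word 1≤j j≤max with maxLabel∈word T
  ... | inj₁ ≡0 = contradiction (≤-trans 1≤j (≤-trans j≤max (≤-reflexive ≡0))) λ ()
  ... | inj₂ max∈ = let _ , values = proj₁ mod in
    Equivalence.from (values _) (1≤j , ≤-trans j≤max (proj₂ (Equivalence.to (values _) max∈)))

  block-spec : ∀ {j} → 1 ≤ j → j ≤ maxLabel T → BlockSpec T j (map label (W T j))
  block-spec 1≤j j≤max with v , refl , v∉ ← leftmost T (index∈word 1≤j j≤max) =
    W-spec v (leftmost-isAsctop v v∉)

mainTheorem7 : ∀ (x x′ x+x′ : List ℕ) →
    x ≢ [] → x′ ≢ [] →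
    IsModifiedAscent x → IsModifiedAscent x′ →
    dim (β (ᾱ x)) < dim (β (ᾱ x′)) →
    IsModifiedAscent x+x′ →
    β (ᾱ x+x′) ≡ β (ᾱ x) +ᴹ β (ᾱ x′) →
    x+x′ ≡ α (𝔓 (ᾱ x) +ᶜ 𝔓 (ᾱ x′))
mainTheorem7 x x′ x+x′ _ _ mod mod′ p<k modS β≡ = begin
  x+x′
    ≡⟨ word-ᾱ x+x′ ⟨
  word S
    -- The omitted family consists of the label lists of the paths W_i of `S`. Indices range over
    -- the dimension of `β T′`, which `cong dim β≡` identifies with the largest label of `S`.
    ≡⟨ α-word dS (leftFresh dS modS′) (blocks (𝔓 T +ᶜ 𝔓 T′)) _
         (λ i → block-spec dS modS′ (s≤s z≤n) (≤-trans (toℕ<n i) (≤-reflexive (sym (cong dim β≡)))))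
         (sum-blocks {S} {T} {T′} (<⇒≤ p<k) β≡ posS (positive mod) (positive mod′))
         posS (All.tabulate λ b∈ → ≤-trans (∈word⇒≤maxLabel S b∈) (≤-reflexive (cong dim β≡))) ⟨
  α (𝔓 T +ᶜ 𝔓 T′) ∎
  where
  open ≡-Reasoning
  T  = ᾱ x
  T′ = ᾱ x′
  S  = ᾱ x+x′
  word-ᾱ : ∀ y → word (ᾱ y) ≡ y
  word-ᾱ y = word-ᾱ-acc y _
  dS : Decreasing S
  dS = ᾱ-acc-decreasing x+x′ _
  modS′ : IsModifiedAscent (word S)
  modS′ = subst IsModifiedAscent (sym (word-ᾱ x+x′)) modS
  positive : ∀ {y} → IsModifiedAscent y → All (1 ≤_) (word (ᾱ y))
  positive {y} m = subst (All (1 ≤_)) (sym (word-ᾱ y)) (IsCayley⇒positive (proj₁ m))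
  posS : All (1 ≤_) (word S)
  posS = positive modS
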